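{- Let $\mathcal{M}$ and $\mathcal{N}$ be two matroids on the same finite ground set $S$, and let $n\ge 1$. Let $F_1,\ldots,F_n\subseteq S$ be pairwise disjoint sets, each of size $n$, and each independent in both $\mathcal{M}$ and $\mathcal{N}$. Then there exists a partial rainbow set $R$ for $(F_1,\ldots,F_n)$ with $|R|\ge n-\sqrt{n}$ such that $R$ is independent in both $\mathcal{M}$ and $\mathcal{N}$.
   Context: For a family of sets $(F_1,\ldots,F_n)$, a partial rainbow function is a partial choice function, i.e. a function defined on a subset of $\{1,\ldots,n\}$ assigning to each $i$ in its domain an element of $F_i$. A partial rainbow set is the range of a partial rainbow function, i.e. a set containing at most one element from each $F_i$ (with elements chosen from different $F_i$'s; here the $F_i$ are disjoint, so this is an ordinary set). -}

module Defs where

open import Data.Nat using (ℕ; _<_)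
open import Data.Fin using (Fin)
open import Data.Fin.Subset using (Subset; ⊥; _∈_; _∉_; _⊆_; _∪_; ⁅_⁆; ∣_∣)
open import Data.Maybe using (Maybe; just)
open import Data.Product using (Σ; ∃; _×_; proj₁)
open import Data.Empty using () renaming (⊥ to False)
open import Relation.Binary.PropositionalEquality using (_≡_; _≢_)
open import Function.Bundles using (_⇔_)

record Matroid (m : ℕ) : Set₁ where
  field
    Indep     : Subset m → Set
    indep-∅   : Indep ⊥
    indep-⊆   : ∀ {X Y} → Y ⊆ X → Indep X → Indep Y
    exchange  : ∀ {X Y} → Indep X → Indep Y → ∣ X ∣ < ∣ Y ∣ →
                Σ (Fin m) λ y → y ∈ Y × y ∉ X × Indep (X ∪ ⁅ y ⁆)
open Matroid public

PairwiseDisjoint : ∀ {n m} → (Fin n → Subset m) → Set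
PairwiseDisjoint {n} F = ∀ (i j : Fin n) x → i ≢ j → x ∈ F i → x ∈ F j → False

PartialRainbowFunction : ∀ {n m} → (Fin n → Subset m) → Set
PartialRainbowFunction {n} {m} F =
  Σ (Fin n → Maybe (Fin m)) λ g → ∀ i x → g i ≡ just x → x ∈ F i

IsPartialRainbowSet : ∀ {n m} → (Fin n → Subset m) → Subset m → Set
IsPartialRainbowSet {n} {m} F R =
  Σ (PartialRainbowFunction F) λ pg →
    ∀ x → (x ∈ R) ⇔ (∃ λ (i : Fin n) → proj₁ pg i ≡ just x)

{-# OPTIONS --safe #-}

-- Let R be a rainbow common independent set and k = n − |R|, so that at least k
-- classes miss R.  These classes are processed one at a time, maintaining a set
-- P ⊆ R of elements that can be exchanged out of R.  If F_c is the next class,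
-- G the set of g ∈ F_c independent of R ∖ P in M, and no augmentation exists,
-- then G lies in the N-closure of R.  Adding to P the N-fundamental circuits of
-- the elements of G gives P′ whose N-closure contains G, whence
-- |P′| ≥ |G| ≥ n − |R ∖ P| = |P| + k.  After k classes k² ≤ |P| ≤ |R| ≤ n.
--
-- Independence is not assumed decidable.  Closing the family of subsets of the
-- F_i under the given exchange function yields a decidable matroid all of whose
-- independent sets are independent in the original one, and the argument is
-- carried out there.
module Submission where

open import Defs
open import Data.Nat using (ℕ; zero; suc; _+_; _≤_; _<_; _∸_; _*_; s≤s; z≤n; s≤s⁻¹; _≤?_; _<?_)
open import Data.Nat.Properties hiding (suc-injective)
open import Data.Bool using (if_then_else_)
open import Data.Fin using (Fin; zero; suc)
open import Data.Fin.Properties using (any?; suc-injective) renaming (_≟_ to _≟ᶠ_)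
open import Data.Fin.Subset using (Subset; inside; outside; ⊥; _∈_; _∉_; _⊆_; _∪_; _∩_; _─_; _-_; ∁; ⁅_⁆; ∣_∣)
open import Data.Fin.Subset.Properties
open import Data.List using (List; []; _∷_; allFin) renaming (map to mapᴸ)
import Data.List.Relation.Unary.All as All
open import Data.List.Relation.Unary.All using (All; []; _∷_)
open import Data.List.Relation.Unary.All.Properties using () renaming (map⁺ to All-map⁺)
import Data.List.Relation.Unary.Any as Any
open import Data.List.Relation.Unary.Any using (Any) renaming (here to hereᴸ; there to thereᴸ)
open import Data.List.Membership.Propositional using () renaming (_∈_ to _∈ᴸ_)
open import Data.List.Membership.Propositional.Properties using (∈-map⁺; ∈-allFin)
open import Data.Maybe using (Maybe; just; nothing)
open import Data.Product using (Σ; ∃; _×_; _,_; proj₁; proj₂)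
open import Data.Sum using (_⊎_; inj₁; inj₂)
open import Data.Vec using (tabulate; here; there) renaming ([] to []ᵛ; _∷_ to _∷ᵛ_)
open import Data.Vec.Properties using (lookup∘tabulate; []=⇒lookup; lookup⇒[]=)
open import Function using (_∘_; id; mk⇔)
open import Relation.Binary.PropositionalEquality using (_≡_; _≢_; refl; sym; trans; cong; subst)
open import Relation.Nullary using (¬_; Dec; yes; no; does; contradiction)
open import Relation.Nullary.Decidable using (_×-dec_; ¬?; dec-true)
open import Relation.Unary using (Decidable)

private
  variable
    m n : ℕ

-- Finite subsets

infixl 6 _⊕_

_⊕_ : Subset m → Fin m → Subset m
X ⊕ f = X ∪ ⁅ f ⁆

x∈p⇒x∈p⊕y : ∀ {p : Subset m} {x y} → x ∈ p → x ∈ p ⊕ y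
x∈p⇒x∈p⊕y x∈p = x∈p∪q⁺ (inj₁ x∈p)

y∈p⊕y : ∀ {p : Subset m} {y} → y ∈ p ⊕ y
y∈p⊕y {y = y} = x∈p∪q⁺ (inj₂ (x∈⁅x⁆ y))

x∈p⊕y⁻ : ∀ {p : Subset m} {x y} → x ∈ p ⊕ y → x ∈ p ⊎ x ≡ y
x∈p⊕y⁻ {p = p} {y = y} x∈ with x∈p∪q⁻ p ⁅ y ⁆ x∈
... | inj₁ x∈p = inj₁ x∈p
... | inj₂ x∈y = inj₂ (x∈⁅y⁆⇒x≡y y x∈y)

⊕-least : ∀ {p q : Subset m} {y} → p ⊆ q → y ∈ q → p ⊕ y ⊆ q
⊕-least p⊆q y∈q x∈ with x∈p⊕y⁻ x∈
... | inj₁ x∈p  = p⊆q x∈p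
... | inj₂ refl = y∈q

⊕-mono : ∀ {p q : Subset m} {y} → p ⊆ q → p ⊕ y ⊆ q ⊕ y
⊕-mono p⊆q = ⊕-least (x∈p⇒x∈p⊕y ∘ p⊆q) y∈p⊕y

x∈p─q⇒x∉q : ∀ (p q : Subset m) {x} → x ∈ p ─ q → x ∉ q
x∈p─q⇒x∉q (_ ∷ᵛ p) (_ ∷ᵛ q) (there x∈) (there x∈q) = x∈p─q⇒x∉q p q x∈ x∈q

x∈p-y⇒x≢y : ∀ (p : Subset m) {x y} → x ∈ p - y → x ≢ y
x∈p-y⇒x≢y p {y = y} x∈ refl = x∈p─q⇒x∉q p ⁅ y ⁆ x∈ (x∈⁅x⁆ y)

p-y⊆p : ∀ (p : Subset m) {y} → p - y ⊆ p
p-y⊆p p {y} = p─q⊆p p ⁅ y ⁆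

p-x-mono : ∀ {p q : Subset m} {y} → p ⊆ q → p - y ⊆ q - y
p-x-mono {p = p} p⊆q x∈ = x∈p∧x≢y⇒x∈p-y (p⊆q (p-y⊆p p x∈)) (x∈p-y⇒x≢y p x∈)

∣p─q∣+∣p∩q∣≡∣p∣ : ∀ (p q : Subset m) → ∣ p ─ q ∣ + ∣ p ∩ q ∣ ≡ ∣ p ∣
∣p─q∣+∣p∩q∣≡∣p∣ []ᵛ            []ᵛ            = refl
∣p─q∣+∣p∩q∣≡∣p∣ (outside ∷ᵛ p) (outside ∷ᵛ q) = ∣p─q∣+∣p∩q∣≡∣p∣ p q
∣p─q∣+∣p∩q∣≡∣p∣ (outside ∷ᵛ p) (inside  ∷ᵛ q) = ∣p─q∣+∣p∩q∣≡∣p∣ p q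
∣p─q∣+∣p∩q∣≡∣p∣ (inside  ∷ᵛ p) (outside ∷ᵛ q) = cong suc (∣p─q∣+∣p∩q∣≡∣p∣ p q)
∣p─q∣+∣p∩q∣≡∣p∣ (inside  ∷ᵛ p) (inside  ∷ᵛ q) =
  trans (+-suc ∣ p ─ q ∣ ∣ p ∩ q ∣) (cong suc (∣p─q∣+∣p∩q∣≡∣p∣ p q))

∣p∪q∣≤∣p∣+∣q∣ : ∀ (p q : Subset m) → ∣ p ∪ q ∣ ≤ ∣ p ∣ + ∣ q ∣
∣p∪q∣≤∣p∣+∣q∣ []ᵛ            []ᵛ            = z≤n
∣p∪q∣≤∣p∣+∣q∣ (outside ∷ᵛ p) (outside ∷ᵛ q) = ∣p∪q∣≤∣p∣+∣q∣ p q
∣p∪q∣≤∣p∣+∣q∣ (inside  ∷ᵛ p) (outside ∷ᵛ q) = s≤s (∣p∪q∣≤∣p∣+∣q∣ p q)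
∣p∪q∣≤∣p∣+∣q∣ (outside ∷ᵛ p) (inside  ∷ᵛ q) =
  ≤-trans (s≤s (∣p∪q∣≤∣p∣+∣q∣ p q)) (≤-reflexive (sym (+-suc ∣ p ∣ ∣ q ∣)))
∣p∪q∣≤∣p∣+∣q∣ (inside  ∷ᵛ p) (inside  ∷ᵛ q) =
  s≤s (≤-trans (∣p∪q∣≤∣p∣+∣q∣ p q) (+-monoʳ-≤ ∣ p ∣ (n≤1+n ∣ q ∣)))

∣p⊕x∣≤1+∣p∣ : ∀ (p : Subset m) x → ∣ p ⊕ x ∣ ≤ suc ∣ p ∣
∣p⊕x∣≤1+∣p∣ p x = begin
  ∣ p ⊕ x ∣         ≤⟨ ∣p∪q∣≤∣p∣+∣q∣ p ⁅ x ⁆ ⟩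
  ∣ p ∣ + ∣ ⁅ x ⁆ ∣ ≡⟨ cong (∣ p ∣ +_) (∣⁅x⁆∣≡1 x) ⟩
  ∣ p ∣ + 1         ≡⟨ +-comm ∣ p ∣ 1 ⟩
  suc ∣ p ∣         ∎
  where open ≤-Reasoning

x∉p⇒∣p∣<∣p⊕x∣ : ∀ {p : Subset m} {x} → x ∉ p → ∣ p ∣ < ∣ p ⊕ x ∣
x∉p⇒∣p∣<∣p⊕x∣ {x = x} x∉p = p⊂q⇒∣p∣<∣q∣ (x∈p⇒x∈p⊕y , x , y∈p⊕y , x∉p)

p⊆p-x⊕x : ∀ {p : Subset m} {x} → p ⊆ (p - x) ⊕ x
p⊆p-x⊕x {x = x} {y} y∈p with y ≟ᶠ x
... | yes refl = y∈p⊕y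
... | no  y≢x  = x∈p⇒x∈p⊕y (x∈p∧x≢y⇒x∈p-y y∈p y≢x)

∣p∣≤1+∣p-x∣ : ∀ (p : Subset m) x → ∣ p ∣ ≤ suc ∣ p - x ∣
∣p∣≤1+∣p-x∣ p x = ≤-trans (p⊆q⇒∣p∣≤∣q∣ (p⊆p-x⊕x {p = p} {x})) (∣p⊕x∣≤1+∣p∣ (p - x) x)

∣p-x⊕y∣≤∣p∣ : ∀ {p : Subset m} {x} y → x ∈ p → ∣ (p - x) ⊕ y ∣ ≤ ∣ p ∣
∣p-x⊕y∣≤∣p∣ {p = p} {x} y x∈p = ≤-trans (∣p⊕x∣≤1+∣p∣ (p - x) y) (x∈p⇒∣p-x∣<∣p∣ x∈p)

p⊆q∧∣q∣≤∣p∣⇒q⊆p : ∀ {p q : Subset m} → p ⊆ q → ∣ q ∣ ≤ ∣ p ∣ → q ⊆ p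
p⊆q∧∣q∣≤∣p∣⇒q⊆p {p = p} p⊆q ∣q∣≤∣p∣ {x} x∈q with x ∈? p
... | yes x∈p = x∈p
... | no  x∉p = contradiction (p⊂q⇒∣p∣<∣q∣ (p⊆q , x , x∈q , x∉p)) (≤⇒≯ ∣q∣≤∣p∣)

comprehension : {P : Fin m → Set} → Decidable P → Subset m
comprehension P? = tabulate (does ∘ P?)

module _ {P : Fin m → Set} (P? : Decidable P) where

  ∈-comprehension⁺ : ∀ {x} → P x → x ∈ comprehension P?
  ∈-comprehension⁺ {x} Px =
    lookup⇒[]= x _ (trans (lookup∘tabulate (does ∘ P?) x) (dec-true (P? x) Px))

  ∈-comprehension⁻ : ∀ {x} → x ∈ comprehension P? → P x
  ∈-comprehension⁻ {x} x∈ with P? x | trans (sym (lookup∘tabulate (does ∘ P?) x)) ([]=⇒lookup x∈)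
  ... | yes Px | _ = Px

-- Removing from `q` the witness of one index leaves the witnesses of later indices in place, since
-- `inj` makes them different from it.
∣p∣≤∣q∣-from-injection : ∀ (p : Subset n) (q : Subset m) (T : Fin n → Fin m → Set) →
  (∀ {i} → i ∈ p → ∃ λ x → x ∈ q × T i x) →
  (∀ {i j x} → T i x → T j x → i ≡ j) → ∣ p ∣ ≤ ∣ q ∣
∣p∣≤∣q∣-from-injection []ᵛ            q T total inj = z≤n
∣p∣≤∣q∣-from-injection (outside ∷ᵛ p) q T total inj =
  ∣p∣≤∣q∣-from-injection p q (T ∘ suc) (total ∘ there) (λ t u → suc-injective (inj t u))
∣p∣≤∣q∣-from-injection (inside  ∷ᵛ p) q T total inj with total here
... | x , x∈q , Tx = ≤-trans (s≤s (∣p∣≤∣q∣-from-injection p (q - x) (T ∘ suc) total′ inj′)) (x∈p⇒∣p-x∣<∣p∣ x∈q)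
  where
  total′ : ∀ {i} → i ∈ p → ∃ λ y → y ∈ q - x × T (suc i) y
  total′ i∈p with total (there i∈p)
  ... | y , y∈q , Ty = y , x∈p∧x≢y⇒x∈p-y y∈q (λ { refl → contradiction (inj Tx Ty) λ () }) , Ty
  inj′ : ∀ {i j y} → T (suc i) y → T (suc j) y → i ≡ j
  inj′ t u = suc-injective (inj t u)

-- Exchange arguments in a matroid

-- For independent `Y`, containment of `X` in the closure of `Y`, phrased without a closure
-- operator.
Spans : Matroid m → Subset m → Subset m → Set
Spans M Y X = ∀ {x} → x ∈ X → x ∉ Y → ¬ Indep M (Y ⊕ x)

module _ (M : Matroid m) where

  Spans⇒∣∣≤∣∣ : ∀ {X Y} → Indep M X → Indep M Y → Spans M Y X → ∣ X ∣ ≤ ∣ Y ∣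
  Spans⇒∣∣≤∣∣ {X} {Y} IX IY span with ∣ X ∣ ≤? ∣ Y ∣
  ... | yes le = le
  ... | no  gt with exchange M IY IX (≰⇒> gt)
  ...   | x , x∈X , x∉Y , IYx = contradiction IYx (span x∈X x∉Y)

  Extension : Subset m → Subset m → Set
  Extension X Y = Σ (Subset m) λ J → Indep M J × X ⊆ J × J ⊆ X ∪ Y × ∣ Y ∣ ≤ ∣ J ∣

  extend : ∀ {X Y} → Indep M X → Indep M Y → Extension X Y
  extend {X} {Y} IX IY = go ∣ Y ∣ IX (m≤m+n ∣ Y ∣ ∣ X ∣)
    where
    -- `d` bounds the number of exchanges still needed to bring `X` up to the size of `Y`.
    go : ∀ d {X} → Indep M X → ∣ Y ∣ ≤ d + ∣ X ∣ → Extension X Y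
    go zero    {X} IX le = X , IX , id , p⊆p∪q Y , le
    go (suc d) {X} IX le with ∣ Y ∣ ≤? ∣ X ∣
    ... | yes Y≤X = X , IX , id , p⊆p∪q Y , Y≤X
    ... | no  Y≰X with exchange M IX IY (≰⇒> Y≰X)
    ...   | y , y∈Y , y∉X , IXy
        with go d IXy (≤-trans le (≤-trans (≤-reflexive (sym (+-suc d ∣ X ∣))) (+-monoʳ-≤ d (x∉p⇒∣p∣<∣p⊕x∣ y∉X))))
    ...     | J , IJ , ⊆J , J⊆ , Y≤J = J , IJ , ⊆J ∘ x∈p⇒x∈p⊕y , J⊆X∪Y , Y≤J
      where
      J⊆X∪Y : J ⊆ X ∪ Y
      J⊆X∪Y x∈J with x∈p∪q⁻ (X ⊕ y) Y (J⊆ x∈J)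
      ... | inj₂ x∈Y = x∈p∪q⁺ (inj₂ x∈Y)
      ... | inj₁ x∈Xy with x∈p⊕y⁻ x∈Xy
      ...   | inj₁ x∈X  = x∈p∪q⁺ (inj₁ x∈X)
      ...   | inj₂ refl = x∈p∪q⁺ (inj₂ y∈Y)

  -- An independent J inside (I - e) ⊕ f that is as large as I fills it.
  indep-swap : ∀ {I J e f} → Indep M J → J ⊆ I ⊕ f → e ∉ J → e ∈ I → ∣ I ∣ ≤ ∣ J ∣ →
    Indep M ((I - e) ⊕ f)
  indep-swap {I} {J} {e} {f} IJ J⊆ e∉J e∈I I≤J =
    indep-⊆ M (p⊆q∧∣q∣≤∣p∣⇒q⊆p J⊆I-e⊕f (≤-trans (∣p-x⊕y∣≤∣p∣ f e∈I) I≤J)) IJ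
    where
    J⊆I-e⊕f : J ⊆ (I - e) ⊕ f
    J⊆I-e⊕f x∈J with x∈p⊕y⁻ (J⊆ x∈J)
    ... | inj₁ x∈I  = x∈p⇒x∈p⊕y (x∈p∧x≢y⇒x∈p-y x∈I λ { refl → e∉J x∈J })
    ... | inj₂ refl = y∈p⊕y

  -- The circuit of A ⊕ f is that of I ⊕ f, so e lies on both.
  swap-mono : ∀ {I A e f} → Indep M I → A ⊆ I → e ∈ I →
    ¬ Indep M (A ⊕ f) → Indep M ((A - e) ⊕ f) → Indep M ((I - e) ⊕ f)
  swap-mono {I} {A} {e} {f} II A⊆I e∈I ¬IAf IA-ef with extend IA-ef II
  ... | J , IJ , ⊆J , J⊆ , I≤J with e ∈? J
  ...   | no  e∉J = indep-swap IJ J⊆I⊕f e∉J e∈I I≤J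
    where
    J⊆I⊕f : J ⊆ I ⊕ f
    J⊆I⊕f x∈J with x∈p∪q⁻ ((A - e) ⊕ f) I (J⊆ x∈J)
    ... | inj₁ x∈  = ⊕-mono (A⊆I ∘ p-y⊆p A) x∈
    ... | inj₂ x∈I = x∈p⇒x∈p⊕y x∈I
  ...   | yes e∈J = contradiction (indep-⊆ M (⊕-least A⊆J (⊆J y∈p⊕y)) IJ) ¬IAf
    where
    A⊆J : A ⊆ J
    A⊆J {x} x∈A with x ≟ᶠ e
    ... | yes refl = e∈J
    ... | no  x≢e  = ⊆J (x∈p⇒x∈p⊕y (x∈p∧x≢y⇒x∈p-y x∈A x≢e))

  -- e is an element outside A of the circuit of I ⊕ f.
  swap-outside : ∀ {I A f} → Indep M I → A ⊆ I → ¬ Indep M (I ⊕ f) → Indep M (A ⊕ f) →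
    ∃ λ e → e ∈ I × e ∉ A × Indep M ((I - e) ⊕ f)
  swap-outside {I} {A} {f} II A⊆I ¬IIf IAf with extend IAf II
  ... | J , IJ , ⊆J , J⊆ , I≤J with any? (λ e → (e ∈? I) ×-dec ¬? (e ∈? J))
  ...   | yes (e , e∈I , e∉J) = e , e∈I , e∉J ∘ ⊆J ∘ x∈p⇒x∈p⊕y , indep-swap IJ J⊆I⊕f e∉J e∈I I≤J
    where
    J⊆I⊕f : J ⊆ I ⊕ f
    J⊆I⊕f x∈J with x∈p∪q⁻ (A ⊕ f) I (J⊆ x∈J)
    ... | inj₁ x∈  = ⊕-mono A⊆I x∈
    ... | inj₂ x∈I = x∈p⇒x∈p⊕y x∈I
  ...   | no none = contradiction (indep-⊆ M (⊕-least I⊆J (⊆J y∈p⊕y)) IJ) ¬IIf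
    where
    I⊆J : I ⊆ J
    I⊆J {x} x∈I with x ∈? J
    ... | yes x∈J = x∈J
    ... | no  x∉J = contradiction (x , x∈I , x∉J) none

  -- Extend `W` from `B ⊕ g` to an independent `J` larger than `B`. If `g` were missing from `J`,
  -- exchange would add to `B` an element of `W`, against `span`.
  indep-⊕-spanned : ∀ {W B g} → Indep M W → Indep M B → Spans M B W →
    g ∉ B → Indep M (B ⊕ g) → Indep M (W ⊕ g)
  indep-⊕-spanned {W} {B} {g} IW IB span g∉B IBg with extend IW IBg
  ... | J , IJ , W⊆J , J⊆ , Bg≤J with g ∈? J
  ...   | yes g∈J = indep-⊆ M (⊕-least W⊆J g∈J) IJ
  ...   | no  g∉J with exchange M IB IJ (≤-trans (x∉p⇒∣p∣<∣p⊕x∣ g∉B) Bg≤J)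
  ...     | x , x∈J , x∉B , IBx with x∈p∪q⁻ W (B ⊕ g) (J⊆ x∈J)
  ...       | inj₁ x∈W = contradiction IBx (span x∈W x∉B)
  ...       | inj₂ x∈Bg with x∈p⊕y⁻ x∈Bg
  ...         | inj₁ x∈B  = contradiction x∈B x∉B
  ...         | inj₂ refl = contradiction x∈J g∉J

-- Decidable submatroids

-- Counts the subsets on which `P` fails; the termination measure for closing a family under
-- exchange.
missing : {P : Subset m → Set} → Decidable P → ℕ
missing {zero}  P? = if does (P? []ᵛ) then 0 else 1
missing {suc m} P? = missing (P? ∘ (inside ∷ᵛ_)) + missing (P? ∘ (outside ∷ᵛ_))

missing-mono : {P Q : Subset m → Set} (P? : Decidable P) (Q? : Decidable Q) →
  (∀ X → P X → Q X) → missing Q? ≤ missing P?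
missing-mono {zero} P? Q? P⇒Q with P? []ᵛ | Q? []ᵛ
... | _     | yes _ = z≤n
... | yes p | no ¬q = contradiction (P⇒Q []ᵛ p) ¬q
... | no _  | no _  = ≤-refl
missing-mono {suc m} P? Q? P⇒Q =
  +-mono-≤ (missing-mono (P? ∘ (inside ∷ᵛ_)) (Q? ∘ (inside ∷ᵛ_)) (P⇒Q ∘ (inside ∷ᵛ_)))
           (missing-mono (P? ∘ (outside ∷ᵛ_)) (Q? ∘ (outside ∷ᵛ_)) (P⇒Q ∘ (outside ∷ᵛ_)))

missing-strict : {P Q : Subset m → Set} (P? : Decidable P) (Q? : Decidable Q) →
  (∀ X → P X → Q X) → ∀ X → ¬ P X → Q X → missing Q? < missing P?
missing-strict P? Q? P⇒Q []ᵛ ¬p q with P? []ᵛ | Q? []ᵛ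
... | yes p | _     = contradiction p ¬p
... | no _  | yes _ = ≤-refl
... | no _  | no ¬q = contradiction q ¬q
missing-strict P? Q? P⇒Q (inside ∷ᵛ X) ¬p q =
  +-mono-<-≤ (missing-strict (P? ∘ (inside ∷ᵛ_)) (Q? ∘ (inside ∷ᵛ_)) (P⇒Q ∘ (inside ∷ᵛ_)) X ¬p q)
             (missing-mono (P? ∘ (outside ∷ᵛ_)) (Q? ∘ (outside ∷ᵛ_)) (P⇒Q ∘ (outside ∷ᵛ_)))
missing-strict P? Q? P⇒Q (outside ∷ᵛ X) ¬p q =
  +-mono-≤-< (missing-mono (P? ∘ (inside ∷ᵛ_)) (Q? ∘ (inside ∷ᵛ_)) (P⇒Q ∘ (inside ∷ᵛ_)))
             (missing-strict (P? ∘ (outside ∷ᵛ_)) (Q? ∘ (outside ∷ᵛ_)) (P⇒Q ∘ (outside ∷ᵛ_)) X ¬p q)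

record DecSubmatroid (M : Matroid m) (L : List (Subset m)) : Set₁ where
  field
    matroid  : Matroid m
    indep?   : Decidable (Indep matroid)
    sound    : ∀ {X} → Indep matroid X → Indep M X
    contains : ∀ {X} → X ∈ᴸ L → Indep matroid X

module _ (M : Matroid m) where

  -- The down-closure of `L`, so that heredity holds by construction.
  Known : List (Subset m) → Subset m → Set
  Known L X = Any (X ⊆_) L

  known? : ∀ L → Decidable (Known L)
  known? L X = Any.any? (X ⊆?_) L

  known-⊆ : ∀ {L X Y} → Y ⊆ X → Known L X → Known L Y
  known-⊆ Y⊆X = Any.map (λ X⊆Z {_} x∈Y → X⊆Z (Y⊆X x∈Y))

  known-sound : ∀ {L X} → All (Indep M) L → Known L X → Indep M X
  known-sound (IZ ∷ _)  (hereᴸ X⊆Z) = indep-⊆ M X⊆Z IZ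
  known-sound (_  ∷ IL) (thereᴸ kX) = known-sound IL kX

  Exchangeable : List (Subset m) → Subset m → Subset m → Set
  Exchangeable L X Y = ∃ λ y → y ∈ Y × y ∉ X × Known L (X ⊕ y)

  exchangeable? : ∀ L X Y → Dec (Exchangeable L X Y)
  exchangeable? L X Y = any? λ y → (y ∈? Y) ×-dec ¬? (y ∈? X) ×-dec known? L (X ⊕ y)

  Violation : List (Subset m) → Set
  Violation L = ∃ λ X → Known L X × ∃ λ Y → Known L Y × ∣ X ∣ < ∣ Y ∣ × ¬ Exchangeable L X Y

  violation? : ∀ L → Dec (Violation L)
  violation? L = anySubset? λ X → known? L X ×-dec anySubset? λ Y →
    known? L Y ×-dec (∣ X ∣ <? ∣ Y ∣) ×-dec ¬? (exchangeable? L X Y)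

  -- Indep need not be decidable, but only finitely many exchanges can produce
  -- an independent set that does not lie below one already found.
  decSubmatroid : ∀ L → All (Indep M) L → DecSubmatroid M L
  -- The empty set is put on the list so that it is known even when `L` is empty.
  decSubmatroid L IL = go (suc (missing (known? (⊥ ∷ L)))) ≤-refl (indep-∅ M ∷ IL) (hereᴸ id)
    (λ {X} X∈L → thereᴸ (Any.map (⊆-reflexive {m}) X∈L))
    where
    go : ∀ d {K} → missing (known? K) < d → All (Indep M) K → Known K ⊥ →
         (∀ {X} → X ∈ᴸ L → Known K X) → DecSubmatroid M L
    go (suc d) {K} (s≤s le) IK k⊥ L⊆K with violation? K
    ... | no ok = record
      { matroid = record
        { Indep    = Known K
        ; indep-∅  = k⊥
        ; indep-⊆  = known-⊆
        ; exchange = exchangeᴷ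
        }
      ; indep?   = known? K
      ; sound    = known-sound IK
      ; contains = L⊆K
      }
      where
      exchangeᴷ : ∀ {X Y} → Known K X → Known K Y → ∣ X ∣ < ∣ Y ∣ → Exchangeable K X Y
      exchangeᴷ {X} {Y} kX kY X<Y with exchangeable? K X Y
      ... | yes e = e
      ... | no ¬e = contradiction (X , kX , Y , kY , X<Y , ¬e) ok
    ... | yes (X , kX , Y , kY , X<Y , ¬e)
        with exchange M (known-sound IK kX) (known-sound IK kY) X<Y
    ...   | y , y∈Y , y∉X , IXy = go d (≤-trans smaller le) (IXy ∷ IK) (thereᴸ k⊥) (thereᴸ ∘ L⊆K)
      where
      -- `X ⊕ y` was not known before, since `y` would then have repaired the violation.
      smaller : missing (known? (X ⊕ y ∷ K)) < missing (known? K)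
      smaller = missing-strict (known? K) (known? (X ⊕ y ∷ K)) (λ _ → thereᴸ) (X ⊕ y)
        (λ k → ¬e (y , y∈Y , y∉X , k)) (hereᴸ id)

-- Rainbow sets

module _ (F : Fin n → Subset m) where

  record Rainbow (X : Subset m) : Set where
    field
      covered : ∀ {x} → x ∈ X → ∃ λ i → x ∈ F i
      unique  : ∀ {i x y} → x ∈ X → y ∈ X → x ∈ F i → y ∈ F i → x ≡ y

  open Rainbow public

  Avoids : Subset m → Subset n → Set
  Avoids X U = ∀ {x i} → x ∈ X → i ∈ U → x ∉ F i

  rainbow-⊥ : Rainbow ⊥
  rainbow-⊥ = record
    { covered = λ x∈ → contradiction x∈ ∉⊥
    ; unique  = λ x∈ → contradiction x∈ ∉⊥
    }

  rainbow-⊆ : ∀ {X Y} → Y ⊆ X → Rainbow X → Rainbow Y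
  rainbow-⊆ Y⊆X rX = record
    { covered = covered rX ∘ Y⊆X
    ; unique  = λ x∈ y∈ → unique rX (Y⊆X x∈) (Y⊆X y∈)
    }

  rainbow⇒partialRainbow : ∀ {R} → Rainbow R → IsPartialRainbowSet F R
  rainbow⇒partialRainbow {R} rR = (choice , choice-∈F) , λ x → mk⇔ chosen choice-∈R
    where
    hit? : ∀ i → Dec (∃ λ x → x ∈ R × x ∈ F i)
    hit? i = any? λ x → (x ∈? R) ×-dec (x ∈? F i)

    choice : Fin n → Maybe (Fin m)
    choice i with hit? i
    ... | yes (x , _) = just x
    ... | no  _       = nothing

    choice-∈F : ∀ i x → choice i ≡ just x → x ∈ F i
    choice-∈F i x eq with hit? i
    choice-∈F i x refl | yes (_ , _ , x∈F) = x∈F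

    choice-∈R : ∀ {x} → (∃ λ i → choice i ≡ just x) → x ∈ R
    choice-∈R (i , eq) with hit? i
    choice-∈R (i , refl) | yes (_ , x∈R , _) = x∈R

    chosen : ∀ {x} → x ∈ R → ∃ λ i → choice i ≡ just x
    chosen {x} x∈R with covered rR x∈R
    ... | i , x∈F = i , choice≡
      where
      choice≡ : choice i ≡ just x
      choice≡ with hit? i
      ... | yes (y , y∈R , y∈F) = cong just (unique rR y∈R x∈R y∈F x∈F)
      ... | no  none            = contradiction (x , x∈R , x∈F) none

  module _ (disjoint : PairwiseDisjoint F) where

    same-class : ∀ {i j x} → x ∈ F i → x ∈ F j → i ≡ j
    same-class {i} {j} {x} x∈i x∈j with i ≟ᶠ j
    ... | yes i≡j = i≡j
    ... | no  i≢j = contradiction x∈j (disjoint i j x i≢j x∈i)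

    rainbow-⊕ : ∀ {X U c g} → Rainbow X → Avoids X U → c ∈ U → g ∈ F c → Rainbow (X ⊕ g)
    rainbow-⊕ {X} {U} {c} {g} rX aX c∈U g∈F = record { covered = cov ; unique = uni }
      where
      cov : ∀ {x} → x ∈ X ⊕ g → ∃ λ i → x ∈ F i
      cov x∈ with x∈p⊕y⁻ x∈
      ... | inj₁ x∈X  = covered rX x∈X
      ... | inj₂ refl = c , g∈F

      g-alone : ∀ {i x} → x ∈ X → x ∈ F i → g ∉ F i
      g-alone x∈X x∈F g∈Fi with same-class g∈F g∈Fi
      ... | refl = aX x∈X c∈U x∈F

      uni : ∀ {i x y} → x ∈ X ⊕ g → y ∈ X ⊕ g → x ∈ F i → y ∈ F i → x ≡ y
      uni x∈ y∈ x∈F y∈F with x∈p⊕y⁻ x∈ | x∈p⊕y⁻ y∈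
      ... | inj₁ x∈X  | inj₁ y∈X  = unique rX x∈X y∈X x∈F y∈F
      ... | inj₁ x∈X  | inj₂ refl = contradiction y∈F (g-alone x∈X x∈F)
      ... | inj₂ refl | inj₁ y∈X  = contradiction x∈F (g-alone y∈X y∈F)
      ... | inj₂ refl | inj₂ refl = refl

    avoids-⊕ : ∀ {X U c g} → Avoids X U → g ∈ F c → Avoids (X ⊕ g) (U - c)
    avoids-⊕ {U = U} aX g∈F x∈ i∈U x∈F with x∈p⊕y⁻ x∈
    ... | inj₁ x∈X  = aX x∈X (p-y⊆p U i∈U) x∈F
    ... | inj₂ refl = x∈p-y⇒x≢y U i∈U (same-class x∈F g∈F)

    -- Each class outside `U` meets `R`, in different elements by disjointness, so at most `∣ R ∣`
    -- classes lie outside `U`.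
    unused : ∀ R → ∃ λ U → Avoids R U × n ∸ ∣ R ∣ ≤ ∣ U ∣
    unused R = U , avoids , card
      where
      hit? : ∀ i → Dec (∃ λ x → x ∈ R × x ∈ F i)
      hit? i = any? λ x → (x ∈? R) ×-dec (x ∈? F i)

      U : Subset n
      U = comprehension (¬? ∘ hit?)

      avoids : Avoids R U
      avoids x∈R i∈U x∈F = ∈-comprehension⁻ (¬? ∘ hit?) i∈U (_ , x∈R , x∈F)

      hit : ∀ {i} → i ∈ ∁ U → ∃ λ x → x ∈ R × x ∈ F i
      hit {i} i∈∁U with hit? i
      ... | yes h = h
      ... | no ¬h = contradiction (∈-comprehension⁺ (¬? ∘ hit?) ¬h) (x∈∁p⇒x∉p i∈∁U)

      n∸U≤R : n ∸ ∣ U ∣ ≤ ∣ R ∣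
      n∸U≤R = ≤-trans (≤-reflexive (sym (∣∁p∣≡n∸∣p∣ U)))
        (∣p∣≤∣q∣-from-injection (∁ U) R (λ i x → x ∈ F i) hit same-class)

      card : n ∸ ∣ R ∣ ≤ ∣ U ∣
      card = m≤n+o⇒m∸n≤o n ∣ R ∣ (begin
        n                       ≤⟨ m≤n+m∸n n ∣ U ∣ ⟩
        ∣ U ∣ + (n ∸ ∣ U ∣)     ≤⟨ +-monoʳ-≤ ∣ U ∣ n∸U≤R ⟩
        ∣ U ∣ + ∣ R ∣           ≡⟨ +-comm ∣ U ∣ ∣ R ∣ ⟩
        ∣ R ∣ + ∣ U ∣           ∎)
        where open ≤-Reasoning

-- Augmentation of common independent rainbow sets

record Common (M N : Matroid m) (F : Fin n → Subset m) (X : Subset m) : Set where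
  constructor common
  field
    indepᴹ  : Indep M X
    indepᴺ  : Indep N X
    rainbow : Rainbow F X

module _
  (M N : Matroid m) (indepᴹ? : Decidable (Indep M)) (indepᴺ? : Decidable (Indep N))
  {F : Fin n → Subset m} (disjoint : PairwiseDisjoint F) (size : ∀ i → ∣ F i ∣ ≡ n)
  (Fᴹ : ∀ i → Indep M (F i)) (Fᴺ : ∀ i → Indep N (F i))
  where

  module Augmentation {R : Subset m} (common-R : Common M N F R) (∣R∣≤n : ∣ R ∣ ≤ n) where

    open Common common-R renaming (indepᴹ to Rᴹ; indepᴺ to Rᴺ; rainbow to rainbow-R)

    k : ℕ
    k = n ∸ ∣ R ∣

    Larger : Set
    Larger = ∃ λ R′ → Common M N F R′ × ∣ R ∣ < ∣ R′ ∣

    -- W replaces R along an alternating path that passes through P only, uses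
    -- no class in U, and makes room for f in M without enlarging the N-closure.
    record Swap (P : Subset m) (U : Subset n) (f : Fin m) : Set where
      field
        W        : Subset m
        W⊕fᴹ     : Indep M (W ⊕ f)
        Wᴺ       : Indep N W
        keeps    : R ─ P ⊆ W
        spanned  : ∀ {w} → w ∈ W → w ∉ R → ¬ Indep N (P ⊕ w)
        large    : ∣ R ∣ ≤ ∣ W ∣
        rainbowᵂ : Rainbow F W
        avoids   : Avoids F W U

    Swappable : Subset m → Subset n → Set
    Swappable P U = ∀ {c f} → c ∈ U → f ∈ F c → Indep M ((R ─ P) ⊕ f) → Swap P U f

    -- The path of length zero: `R` itself serves every `f`.
    swappable-⊥ : ∀ {U} → Avoids F R U → Swappable ⊥ U
    swappable-⊥ R-U c∈U f∈F I = record
      { W        = R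
      ; W⊕fᴹ     = subst (λ X → Indep M (X ⊕ _)) (p─⊥≡p R) I
      ; Wᴺ       = Rᴺ
      ; keeps    = p─q⊆p R ⊥
      ; spanned  = λ w∈R w∉R → contradiction w∈R w∉R
      ; large    = ≤-refl
      ; rainbowᵂ = rainbow-R
      ; avoids   = R-U
      }

    -- Processing one missed class

    module Step {P : Subset m} {U : Subset n} {c : Fin n}
      (P⊆R : P ⊆ R) (R-U : Avoids F R U) (swap : Swappable P U) (c∈U : c ∈ U) where

      G? : Decidable (λ g → g ∈ F c × Indep M ((R ─ P) ⊕ g))
      G? g = (g ∈? F c) ×-dec indepᴹ? ((R ─ P) ⊕ g)

      G : Subset m
      G = comprehension G?

      F∉R : ∀ {g} → g ∈ F c → g ∉ R
      F∉R g∈F g∈R = R-U g∈R c∈U g∈F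

      -- When no augmentation exists, these are the elements of `R` on the N-fundamental circuits of
      -- the elements of `G`: `e` is on the circuit of `g` exactly when trading `e` for `g` keeps
      -- `R` independent.
      R-swap? : Decidable (λ e → e ∈ R × ∃ λ g → g ∈ G × Indep N ((R - e) ⊕ g))
      R-swap? e = (e ∈? R) ×-dec any? λ g → (g ∈? G) ×-dec indepᴺ? ((R - e) ⊕ g)

      P′ : Subset m
      P′ = P ∪ comprehension R-swap?

      P⊆P′ : P ⊆ P′
      P⊆P′ = p⊆p∪q _

      P′⊆R : P′ ⊆ R
      P′⊆R x∈ with x∈p∪q⁻ P _ x∈
      ... | inj₁ x∈P = P⊆R x∈P
      ... | inj₂ x∈S = proj₁ (∈-comprehension⁻ R-swap? x∈S)

      -- `W` has room for `g` in M by construction. In N the closure of `R` contains `W` but not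
      -- `g`, so `g` can be added there too.
      augment : ∀ {g} → g ∈ G → Indep N (R ⊕ g) → Larger
      augment {g} g∈G IRg with ∈-comprehension⁻ G? g∈G
      ... | g∈F , Ig = W ⊕ g , common W⊕fᴹ
            (indep-⊕-spanned N Wᴺ Rᴺ R-spans-W (F∉R g∈F) IRg)
            (rainbow-⊕ F disjoint rainbowᵂ avoids c∈U g∈F)
          , ≤-trans (s≤s large) (x∉p⇒∣p∣<∣p⊕x∣ (λ g∈W → avoids g∈W c∈U g∈F))
        where
        open Swap (swap c∈U g∈F Ig)
        R-spans-W : Spans N R W
        R-spans-W w∈W w∉R = spanned w∈W w∉R ∘ indep-⊆ N (⊕-mono P⊆R)

      module _ (stuck : ∀ {g} → g ∈ G → ¬ Indep N (R ⊕ g)) where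

        -- Otherwise the N-circuit of `R ⊕ g` would have an element of `R` outside `P′`, which was
        -- built to hold them all.
        P′-spans-G : ∀ {g} → g ∈ G → ¬ Indep N (P′ ⊕ g)
        P′-spans-G g∈G I with swap-outside N Rᴺ P′⊆R (stuck g∈G) I
        ... | e , e∈R , e∉P′ , Ie =
          e∉P′ (x∈p∪q⁺ (inj₂ (∈-comprehension⁺ R-swap? (e∈R , _ , g∈G , Ie))))

        ∣G∣≤∣P′∣ : ∣ G ∣ ≤ ∣ P′ ∣
        ∣G∣≤∣P′∣ = Spans⇒∣∣≤∣∣ N
          (indep-⊆ N (proj₁ ∘ ∈-comprehension⁻ G?) (Fᴺ c)) (indep-⊆ N P′⊆R Rᴺ)
          (λ g∈G _ → P′-spans-G g∈G)

        ∣F─G∣≤∣R─P∣ : ∣ F c ─ G ∣ ≤ ∣ R ─ P ∣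
        ∣F─G∣≤∣R─P∣ = Spans⇒∣∣≤∣∣ M
          (indep-⊆ M (p─q⊆p (F c) G) (Fᴹ c)) (indep-⊆ M (p─q⊆p R P) Rᴹ)
          (λ g∈ _ I → x∈p─q⇒x∉q (F c) G g∈ (∈-comprehension⁺ G? (p─q⊆p (F c) G g∈ , I)))

        -- `F c` splits into `G`, of size at most `∣ P′ ∣`, and a remainder spanned in M by `R ─ P`;
        -- on the other side `n` is `k + ∣ P ∣ + ∣ R ─ P ∣`.
        growth : k + ∣ P ∣ ≤ ∣ P′ ∣
        growth = +-cancelʳ-≤ (∣ R ─ P ∣) _ _ (begin
          k + ∣ P ∣ + ∣ R ─ P ∣         ≡⟨ +-assoc k ∣ P ∣ ∣ R ─ P ∣ ⟩
          k + (∣ P ∣ + ∣ R ─ P ∣)       ≡⟨ cong (k +_) (+-comm ∣ P ∣ ∣ R ─ P ∣) ⟩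
          k + (∣ R ─ P ∣ + ∣ P ∣)       ≤⟨ +-monoʳ-≤ k (+-monoʳ-≤ ∣ R ─ P ∣ (p⊆q⇒∣p∣≤∣q∣ P⊆R∩P)) ⟩
          k + (∣ R ─ P ∣ + ∣ R ∩ P ∣)   ≡⟨ cong (k +_) (∣p─q∣+∣p∩q∣≡∣p∣ R P) ⟩
          k + ∣ R ∣                     ≡⟨ m∸n+n≡m ∣R∣≤n ⟩
          n                             ≡⟨ size c ⟨
          ∣ F c ∣                       ≡⟨ ∣p─q∣+∣p∩q∣≡∣p∣ (F c) G ⟨
          ∣ F c ─ G ∣ + ∣ F c ∩ G ∣     ≤⟨ +-mono-≤ ∣F─G∣≤∣R─P∣ (≤-trans (∣p∩q∣≤∣q∣ (F c) G) ∣G∣≤∣P′∣) ⟩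
          ∣ R ─ P ∣ + ∣ P′ ∣            ≡⟨ +-comm ∣ R ─ P ∣ ∣ P′ ∣ ⟩
          ∣ P′ ∣ + ∣ R ─ P ∣            ∎)
          where
          open ≤-Reasoning
          P⊆R∩P : P ⊆ R ∩ P
          P⊆R∩P x∈P = x∈p∩q⁺ (P⊆R x∈P , x∈P)

        -- If `f` was not yet free over `R ─ P`, its M-circuit in `R ⊕ f` has an element `e` newly
        -- put into `P′`, which lies on the N-circuit of some `g` in `G`. The path for `g` is
        -- prolonged by taking `g` in and `e` out, making room for `f`.
        swappable-P′ : Swappable P′ (U - c)
        swappable-P′ {c′} {f} c′∈ f∈F I with indepᴹ? ((R ─ P) ⊕ f)
        -- The earlier swap still serves: enlarging `P` and shrinking `U` only weaken what is
        -- demanded of it.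
        ... | yes I′ = record
          { W        = W
          ; W⊕fᴹ     = W⊕fᴹ
          ; Wᴺ       = Wᴺ
          ; keeps    = keeps ∘ R─P′⊆R─P
          ; spanned  = λ w∈W w∉R → spanned w∈W w∉R ∘ indep-⊆ N (⊕-mono P⊆P′)
          ; large    = large
          ; rainbowᵂ = rainbowᵂ
          ; avoids   = λ w∈W i∈ → avoids w∈W (p-y⊆p U i∈)
          }
          where
          open Swap (swap (p-y⊆p U c′∈) f∈F I′)
          R─P′⊆R─P : R ─ P′ ⊆ R ─ P
          R─P′⊆R─P x∈ = x∈p∧x∉q⇒x∈p─q (p─q⊆p R P′ x∈) (x∈p─q⇒x∉q R P′ x∈ ∘ P⊆P′)
        ... | no ¬I′
            with swap-outside M Rᴹ (p─q⊆p R P′) (¬I′ ∘ indep-⊆ M (⊕-mono (p─q⊆p R P))) I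
        ...   | e , e∈R , e∉R─P′ , Ief = via-e
          where
          e∈P′ : e ∈ P′
          e∈P′ with e ∈? P′
          ... | yes e∈ = e∈
          ... | no  e∉ = contradiction (x∈p∧x∉q⇒x∈p─q e∈R e∉) e∉R─P′

          e∉P : e ∉ P
          e∉P e∈P = ¬I′ (indep-⊆ M (⊕-mono R─P⊆R-e) Ief)
            where
            R─P⊆R-e : R ─ P ⊆ R - e
            R─P⊆R-e x∈ = x∈p∧x≢y⇒x∈p-y (p─q⊆p R P x∈) λ { refl → x∈p─q⇒x∉q R P x∈ e∈P }

          via-e : Swap P′ (U - c) f
          via-e with x∈p∪q⁻ P _ e∈P′
          ... | inj₁ e∈P = contradiction e∈P e∉P
          ... | inj₂ e∈S with ∈-comprehension⁻ R-swap? e∈S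
          ...   | _ , g , g∈G , Ieg with ∈-comprehension⁻ G? g∈G
          ...     | g∈F , Ig = record
            { W        = (W ⊕ g) - e
            -- `e` lies on the M-circuit of `f` over `R ─ P`, which stays the circuit of `f` over
            -- the larger set `W ⊕ g`.
            ; W⊕fᴹ     = swap-mono M W⊕fᴹ (x∈p⇒x∈p⊕y ∘ keeps) (x∈p⇒x∈p⊕y e∈W) ¬I′
                           (indep-⊆ M (⊕-mono (p-x-mono (p─q⊆p R P))) Ief)
            -- `R - e` spans `W - e` in N, because the elements of `W` outside `R` are spanned by
            -- `P`, which lacks `e`.
            ; Wᴺ       = indep-⊆ N W⊕g-e⊆W-e⊕g
                           (indep-⊕-spanned N (indep-⊆ N (p-y⊆p W) Wᴺ) (indep-⊆ N (p-y⊆p R) Rᴺ)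
                             R-e-spans (F∉R g∈F ∘ p-y⊆p R) Ieg)
            ; keeps    = λ x∈ → x∈p∧x≢y⇒x∈p-y
                           (x∈p⇒x∈p⊕y (keeps (x∈p∧x∉q⇒x∈p─q (p─q⊆p R P′ x∈) (x∈p─q⇒x∉q R P′ x∈ ∘ P⊆P′))))
                           λ { refl → e∉R─P′ x∈ }
            ; spanned  = λ w∈ → spanned′ (p-y⊆p (W ⊕ g) w∈)
            ; large    = s≤s⁻¹ (≤-trans (s≤s large)
                           (≤-trans (x∉p⇒∣p∣<∣p⊕x∣ (λ g∈W → avoids g∈W c∈U g∈F)) (∣p∣≤1+∣p-x∣ (W ⊕ g) e)))
            ; rainbowᵂ = rainbow-⊆ F (p-y⊆p (W ⊕ g)) (rainbow-⊕ F disjoint rainbowᵂ avoids c∈U g∈F)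
            ; avoids   = avoids-⊕ F disjoint avoids g∈F ∘ p-y⊆p (W ⊕ g)
            }
            where
            open Swap (swap c∈U g∈F Ig)

            e∈W : e ∈ W
            e∈W = keeps (x∈p∧x∉q⇒x∈p─q e∈R e∉P)

            W⊕g-e⊆W-e⊕g : (W ⊕ g) - e ⊆ (W - e) ⊕ g
            W⊕g-e⊆W-e⊕g x∈ with x∈p⊕y⁻ (p-y⊆p (W ⊕ g) x∈)
            ... | inj₁ x∈W  = x∈p⇒x∈p⊕y (x∈p∧x≢y⇒x∈p-y x∈W (x∈p-y⇒x≢y (W ⊕ g) x∈))
            ... | inj₂ refl = y∈p⊕y

            P⊆R-e : P ⊆ R - e
            P⊆R-e x∈P = x∈p∧x≢y⇒x∈p-y (P⊆R x∈P) λ { refl → e∉P x∈P }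

            R-e-spans : Spans N (R - e) (W - e)
            R-e-spans {w} w∈ w∉ with w ∈? R
            ... | yes w∈R = contradiction (x∈p∧x≢y⇒x∈p-y w∈R (x∈p-y⇒x≢y W w∈)) w∉
            ... | no  w∉R = spanned (p-y⊆p W w∈) w∉R ∘ indep-⊆ N (⊕-mono P⊆R-e)

            spanned′ : ∀ {w} → w ∈ W ⊕ g → w ∉ R → ¬ Indep N (P′ ⊕ w)
            spanned′ w∈ w∉R with x∈p⊕y⁻ w∈
            ... | inj₁ w∈W  = spanned w∈W w∉R ∘ indep-⊆ N (⊕-mono P⊆P′)
            ... | inj₂ refl = P′-spans-G g∈G

      step : Larger ⊎ ∃ λ Q → Q ⊆ R × Swappable Q (U - c) × k + ∣ P ∣ ≤ ∣ Q ∣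
      step with any? (λ g → (g ∈? G) ×-dec indepᴺ? (R ⊕ g))
      ... | yes (g , g∈G , I) = inj₁ (augment g∈G I)
      ... | no none = inj₂ (P′ , P′⊆R , swappable-P′ stuck , growth stuck)
        where
        stuck : ∀ {g} → g ∈ G → ¬ Indep N (R ⊕ g)
        stuck g∈G I = none (_ , g∈G , I)

    -- Each step removes one class from `U` and raises `∣ P ∣` by at least `k`, which preserves the
    -- last hypothesis; once `U` is empty it reads `k * k ≤ ∣ P ∣`.
    iterate : ∀ d {P U} → ∣ U ∣ ≤ d → P ⊆ R → Avoids F R U → Swappable P U →
      k * k ≤ ∣ P ∣ + k * ∣ U ∣ → Larger ⊎ k * k ≤ n
    iterate d {P} {U} U≤d P⊆R R-U swap inv with nonempty? U
    ... | no empty = inj₂ (begin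
      k * k               ≤⟨ inv ⟩
      ∣ P ∣ + k * ∣ U ∣   ≡⟨ cong (λ u → ∣ P ∣ + k * u) (trans (cong ∣_∣ (Empty-unique empty)) (∣⊥∣≡0 n)) ⟩
      ∣ P ∣ + k * 0       ≡⟨ cong (∣ P ∣ +_) (*-zeroʳ k) ⟩
      ∣ P ∣ + 0           ≡⟨ +-identityʳ ∣ P ∣ ⟩
      ∣ P ∣               ≤⟨ p⊆q⇒∣p∣≤∣q∣ P⊆R ⟩
      ∣ R ∣               ≤⟨ ∣R∣≤n ⟩
      n                   ∎)
      where open ≤-Reasoning
    iterate zero {P} {U} U≤0 P⊆R R-U swap inv | yes (c , c∈U) =
      contradiction (≤-trans (x∈p⇒∣p-x∣<∣p∣ c∈U) U≤0) λ ()
    iterate (suc d) {P} {U} U≤d P⊆R R-U swap inv | yes (c , c∈U)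
      with Step.step P⊆R R-U swap c∈U
    ... | inj₁ larger = inj₁ larger
    ... | inj₂ (Q , Q⊆R , swap′ , grow) =
      iterate d (s≤s⁻¹ (≤-trans (x∈p⇒∣p-x∣<∣p∣ c∈U) U≤d)) Q⊆R
        (λ x∈R i∈ → R-U x∈R (p-y⊆p U i∈)) swap′ inv′
      where
      open ≤-Reasoning
      inv′ : k * k ≤ ∣ Q ∣ + k * ∣ U - c ∣
      inv′ = begin
        k * k                         ≤⟨ inv ⟩
        ∣ P ∣ + k * ∣ U ∣             ≤⟨ +-monoʳ-≤ ∣ P ∣ (*-monoʳ-≤ k (∣p∣≤1+∣p-x∣ U c)) ⟩
        ∣ P ∣ + k * suc ∣ U - c ∣     ≡⟨ cong (∣ P ∣ +_) (*-suc k ∣ U - c ∣) ⟩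
        ∣ P ∣ + (k + k * ∣ U - c ∣)   ≡⟨ +-assoc ∣ P ∣ k (k * ∣ U - c ∣) ⟨
        ∣ P ∣ + k + k * ∣ U - c ∣     ≡⟨ cong (_+ k * ∣ U - c ∣) (+-comm ∣ P ∣ k) ⟩
        k + ∣ P ∣ + k * ∣ U - c ∣     ≤⟨ +-monoˡ-≤ (k * ∣ U - c ∣) grow ⟩
        ∣ Q ∣ + k * ∣ U - c ∣         ∎

    larger-or-done : Larger ⊎ k * k ≤ n
    larger-or-done with unused F disjoint R
    ... | U , R-U , k≤U = iterate ∣ U ∣ ≤-refl (λ x∈⊥ → contradiction x∈⊥ ∉⊥) R-U (swappable-⊥ R-U)
      -- At the start `P` is empty, and `k * ∣ U ∣` alone covers `k * k` because at least `k`
      -- classes miss `R`.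
      (≤-trans (*-monoʳ-≤ k k≤U) (m≤n+m (k * ∣ U ∣) ∣ ⊥ {m} ∣))

  -- Augment from the empty set. Every round raises `∣ R ∣`, so after at most `n` rounds either the
  -- bound is reached or `n ∸ ∣ R ∣` is zero and it is trivial.
  large-common : ∃ λ R → Common M N F R × (n ∸ ∣ R ∣) * (n ∸ ∣ R ∣) ≤ n
  large-common = go n (common (indep-∅ M) (indep-∅ N) (rainbow-⊥ F)) (m≤m+n n ∣ ⊥ {m} ∣)
    where
    full : ∀ R → n ≤ ∣ R ∣ → (n ∸ ∣ R ∣) * (n ∸ ∣ R ∣) ≤ n
    full R n≤R rewrite m≤n⇒m∸n≡0 n≤R = z≤n

    go : ∀ d {R} → Common M N F R → n ≤ d + ∣ R ∣ → ∃ λ R → Common M N F R × (n ∸ ∣ R ∣) * (n ∸ ∣ R ∣) ≤ n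
    go zero    {R} common-R le = R , common-R , full R le
    go (suc d) {R} common-R le with ≤-total n ∣ R ∣
    ... | inj₁ n≤R = R , common-R , full R n≤R
    ... | inj₂ R≤n with Augmentation.larger-or-done common-R R≤n
    ...   | inj₂ done = R , common-R , done
    ...   | inj₁ (R′ , common-R′ , R<R′) =
      go d common-R′ (≤-trans le (≤-trans (≤-reflexive (sym (+-suc d ∣ R ∣))) (+-monoʳ-≤ d R<R′)))

-- Reduction to decidable matroids

theorem1p4 : ∀ {m : ℕ} (M N : Matroid m) (n : ℕ) → 1 ≤ n →
    (F : Fin n → Subset m) →
    PairwiseDisjoint F →
    (∀ i → ∣ F i ∣ ≡ n) →
    (∀ i → Indep M (F i) × Indep N (F i)) →
    Σ (Subset m) λ R →
    IsPartialRainbowSet F R ×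
    (n ∸ ∣ R ∣) * (n ∸ ∣ R ∣) ≤ n ×
    Indep M R × Indep N R
theorem1p4 M N n _ F disjoint size indep = R ,
    rainbow⇒partialRainbow F rainbow , bound , sound M′ indepᴹ , sound N′ indepᴺ
  where
  open DecSubmatroid

  -- Seeding both submatroids with the classes keeps the hypotheses on `F`; `sound` carries the
  -- resulting set back to M and N.
  classes = mapᴸ F (allFin n)

  M′ = decSubmatroid M classes (All-map⁺ (All.universal (proj₁ ∘ indep) (allFin n)))
  N′ = decSubmatroid N classes (All-map⁺ (All.universal (proj₂ ∘ indep) (allFin n)))

  class∈ : ∀ i → F i ∈ᴸ classes
  class∈ i = ∈-map⁺ F (∈-allFin i)

  result = large-common (matroid M′) (matroid N′) (indep? M′) (indep? N′) disjoint size
    (contains M′ ∘ class∈) (contains N′ ∘ class∈)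

  R = proj₁ result
  bound = proj₂ (proj₂ result)
  open Common (proj₁ (proj₂ result))
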